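{- Let $\mathfrak G_{\mathbb N}$ be the infinite undirected graph with vertex set $\mathbb N$ and edges $\{a,a+1\}$ for all $a\in\mathbb N$. For all $a,b,c,d\in\mathbb N$, $$\mathfrak G_{\mathbb N}\models a:b::_P c:d\iff |a-b|=|c-d|.$$
   Context: For undirected graphs (edges are one- or two-element vertex sets, $uEv$ iff $\{u,v\}$ is an edge): path formulas $\pi_0(x,y):\equiv x=y$, $\pi_1(x,y):\equiv xEy$, $\pi_n(x,y):\equiv\exists z_1\ldots z_{n-1}(xEz_1\wedge\cdots\wedge z_{n-1}Ey)$ for $n\ge2$. Path type $\uparrow^P_{\mathfrak G}(a\to b)=\{\pi_n:\mathfrak G\models\pi_n(a,b)\}$; $\uparrow^P_{\mathfrak G}(a\to b:\cdot\, c\to d)=\uparrow^P_{\mathfrak G}(a\to b)\cap\uparrow^P_{\mathfrak G}(c\to d)$. A path formula is trivial iff it lies in $\uparrow^P_{\mathfrak G}(a\to b:\cdot\, c\to d)$ for all vertices $a,b,c,d$; $\emptyset_{\mathfrak G}$ is the set of these. $\mathfrak G\models a\to b:\cdot_P\, c\to d$ iff either $\uparrow^P_{\mathfrak G}(a\to b)\cup\uparrow^P_{\mathfrak G}(c\to d)$ consists only of trivial formulas, or $\uparrow^P_{\mathfrak G}(a\to b:\cdot\, c\to d)$ contains a non-trivial formula and for every vertex $d'$, $\emptyset_{\mathfrak G}\subsetneq\uparrow^P(a\to b:\cdot\, c\to d)\subseteq\uparrow^P(a\to b:\cdot\, c\to d')$ implies $\emptyset_{\mathfrak G}\subsetneq\uparrow^P(a\to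 b:\cdot\, c\to d')\subseteq\uparrow^P(a\to b:\cdot\, c\to d)$. $\mathfrak G\models a:b::_P c:d$ iff $\mathfrak G\models a\to b:\cdot_P\, c\to d$, $b\to a:\cdot_P\, d\to c$, $c\to d:\cdot_P\, a\to b$ and $d\to c:\cdot_P\, b\to a$. -}

module Defs where

open import Data.Nat.Base using (ℕ; zero; suc)
open import Data.Product.Base using (_×_; _,_; ∃; ∃₂)
open import Data.Sum.Base using (_⊎_)
open import Data.Vec.Base using (Vec; []; _∷_)
open import Level using (0ℓ)
open import Relation.Binary.Definitions using (_Respects_)
open import Relation.Binary.PropositionalEquality.Core using (_≡_)
open import Relation.Unary using (Pred; _∈_; _∉_; _⊆_; _⊂_; _∩_; _∪_; _≐_; ｛_｝)
open import Relation.Unary.Properties using (≐-sym; ≐-trans)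

-- The set {u , v}; it has one element when u ≡ v.
pair : {V : Set} → V → V → Pred V 0ℓ
pair u v = ｛ u ｝ ∪ ｛ v ｝

-- Subsets are predicates, so the edge set has to respect extensional equality.
record UndirectedGraph : Set₁ where
  field
    Vertex     : Set
    Edge       : Pred (Pred Vertex 0ℓ) 0ℓ
    Edge-resp  : Edge Respects _≐_
    Edge-pairs : ∀ {S} → S ∈ Edge → ∃₂ λ u v → S ≐ pair u v

  infix 4 _E_
  _E_ : Vertex → Vertex → Set
  u E v = pair u v ∈ Edge

data PathFormula : Set where
  π : ℕ → PathFormula

module _ (G : UndirectedGraph) where
  open UndirectedGraph G

  -- x E z₁ × z₁ E z₂ × … × zₖ E y
  Chain : ∀ {k} → Vertex → Vec Vertex k → Vertex → Set
  Chain x []       y = x E y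
  Chain x (z ∷ zs) y = x E z × Chain z zs y

  Satisfies : PathFormula → Vertex → Vertex → Set
  Satisfies (π 0)             x y = x ≡ y
  Satisfies (π 1)             x y = x E y
  Satisfies (π (suc (suc k))) x y = ∃ λ (zs : Vec Vertex (suc k)) → Chain x zs y

  ↑ : Vertex → Vertex → Pred PathFormula 0ℓ
  ↑ a b φ = Satisfies φ a b

  ↑∩ : Vertex → Vertex → Vertex → Vertex → Pred PathFormula 0ℓ
  ↑∩ a b c d = ↑ a b ∩ ↑ c d

  Trivial : Pred PathFormula 0ℓ
  Trivial φ = ∀ a b c d → φ ∈ ↑∩ a b c d

  ArrowProportion : Vertex → Vertex → Vertex → Vertex → Set
  ArrowProportion a b c d =
      (↑ a b ∪ ↑ c d ⊆ Trivial)
    ⊎ (∃ λ φ → φ ∈ ↑∩ a b c d × φ ∉ Trivial)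
      × (∀ d′ →
           (Trivial ⊂ ↑∩ a b c d)  × (↑∩ a b c d  ⊆ ↑∩ a b c d′) →
           (Trivial ⊂ ↑∩ a b c d′) × (↑∩ a b c d′ ⊆ ↑∩ a b c d))

  Proportion : Vertex → Vertex → Vertex → Vertex → Set
  Proportion a b c d =
      ArrowProportion a b c d
    × ArrowProportion b a d c
    × ArrowProportion c d a b
    × ArrowProportion d c b a

infix 3 _⊨_∶_∷ₚ_∶_

_⊨_∶_∷ₚ_∶_ : (G : UndirectedGraph) (a b c d : UndirectedGraph.Vertex G) → Set
G ⊨ a ∶ b ∷ₚ c ∶ d = Proportion G a b c d

𝔊ℕ : UndirectedGraph
𝔊ℕ = record
  { Vertex     = ℕ
  ; Edge       = λ S → ∃ λ a → S ≐ pair a (suc a)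
  ; Edge-resp  = λ S≐T (a , S≐e) → a , ≐-trans (≐-sym S≐T) S≐e
  ; Edge-pairs = λ (a , S≐e) → a , suc a , S≐e
  }

{-# OPTIONS --safe #-}

-- In 𝔊ℕ the path type of a → b is { π n : n = ∣ a - b ∣ + 2 k }, so it is determined by ∣ a - b ∣ and has
-- π ∣ a - b ∣ as its least element; in particular no path formula is trivial.  Taking d′ = c + ∣ a - b ∣, the
-- maximality clause of a → b :· c → d forces ∣ c - d ∣ ≤ ∣ a - b ∣, and the arrow proportion with the two
-- sides exchanged gives the reverse inequality.
module Submission where

open import Data.Nat.Base using (ℕ; zero; suc; _+_; _*_; _≤_; ∣_-_∣)
open import Data.Nat.Properties
  using (+-identityʳ; m≤m+n; ≤-antisym; n≮n; ∣-∣-comm; ∣-∣-identityʳ; ∣n-n∣≡0; ∣m-n∣≡0⇒m≡n; ∣m-m+n∣≡n)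
open import Data.Nat.Tactic.RingSolver using (solve-∀)
open import Data.Product.Base using (_×_; _,_; ∃; proj₁; proj₂)
open import Data.Sum.Base using (_⊎_; inj₁; inj₂; swap)
open import Data.Vec.Base using ([]; _∷_)
open import Function.Bundles using (_⇔_; mk⇔)
open import Relation.Binary.PropositionalEquality.Core using (_≡_; refl; sym; trans; cong; subst)
open import Relation.Unary using (_∈_; _∉_; _⊆_; _⊂_)
open import Relation.Unary.Properties using (≐-refl)
open import Defs

module _ (G : UndirectedGraph) where
  open UndirectedGraph G

  -- `Satisfies` treats the lengths 0, 1 and at least 2 separately; with `π-uncons` this gives a
  -- uniform recursion on walks, one edge at a time.
  π-cons : ∀ n {x y z} → x E z → π n ∈ ↑ G z y → π (suc n) ∈ ↑ G x y
  π-cons 0             xEz refl      = xEz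
  π-cons 1             xEz zEy       = _ ∷ [] , xEz , zEy
  π-cons (suc (suc n)) xEz (zs , ch) = _ ∷ zs , xEz , ch

  π-uncons : ∀ n {x y} → π (suc n) ∈ ↑ G x y → ∃ λ z → x E z × π n ∈ ↑ G z y
  π-uncons 0             xEy                  = _ , xEy , refl
  π-uncons 1             (z ∷ [] , xEz , zEy) = z , xEz , zEy
  π-uncons (suc (suc n)) (z ∷ zs , xEz , ch)  = z , xEz , zs , ch

open UndirectedGraph 𝔊ℕ using (_E_)

n-E-1+n : ∀ {n} → n E suc n
n-E-1+n = _ , ≐-refl

1+n-E-n : ∀ {n} → suc n E n
1+n-E-n = _ , swap , swap

E⇒consecutive : ∀ {x z} → x E z → z ≡ suc x ⊎ x ≡ suc z
E⇒consecutive (c , ⊆c , c⊆) with ⊆c (inj₁ refl) | ⊆c (inj₂ refl) | c⊆ (inj₁ refl) | c⊆ (inj₂ refl)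
... | inj₁ refl | inj₂ refl | _         | _         = inj₁ refl
... | inj₂ refl | inj₁ refl | _         | _         = inj₂ refl
-- Loops are excluded by the reverse inclusion: `pair x z` must contain both `c` and `suc c`, so `x`
-- and `z` cannot coincide.
... | inj₁ refl | inj₁ refl | _         | inj₁ ()
... | inj₁ refl | inj₁ refl | _         | inj₂ ()
... | inj₂ refl | inj₂ refl | inj₁ ()   | _
... | inj₂ refl | inj₂ refl | inj₂ ()   | _

∣1+m-n∣≡1+∣m-n∣⊎∣m-n∣≡1+∣1+m-n∣ : ∀ m n → ∣ suc m - n ∣ ≡ suc ∣ m - n ∣ ⊎ ∣ m - n ∣ ≡ suc ∣ suc m - n ∣
∣1+m-n∣≡1+∣m-n∣⊎∣m-n∣≡1+∣1+m-n∣ zero    zero    = inj₁ refl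
∣1+m-n∣≡1+∣m-n∣⊎∣m-n∣≡1+∣1+m-n∣ (suc m) zero    = inj₁ refl
∣1+m-n∣≡1+∣m-n∣⊎∣m-n∣≡1+∣1+m-n∣ zero    (suc n) = inj₂ refl
∣1+m-n∣≡1+∣m-n∣⊎∣m-n∣≡1+∣1+m-n∣ (suc m) (suc n) = ∣1+m-n∣≡1+∣m-n∣⊎∣m-n∣≡1+∣1+m-n∣ m n

E⇒distance±1 : ∀ {x z} y → x E z → ∣ z - y ∣ ≡ suc ∣ x - y ∣ ⊎ ∣ x - y ∣ ≡ suc ∣ z - y ∣
E⇒distance±1 {x} {z} y xEz with E⇒consecutive xEz
... | inj₁ refl = ∣1+m-n∣≡1+∣m-n∣⊎∣m-n∣≡1+∣1+m-n∣ x y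
... | inj₂ refl = swap (∣1+m-n∣≡1+∣m-n∣⊎∣m-n∣≡1+∣1+m-n∣ z y)

E-suc : ∀ {x z} → x E z → suc x E suc z
E-suc xEz with E⇒consecutive xEz
... | inj₁ refl = n-E-1+n
... | inj₂ refl = 1+n-E-n

step-towards : ∀ x y {m} → ∣ x - y ∣ ≡ suc m → ∃ λ z → x E z × ∣ z - y ∣ ≡ m
step-towards zero    (suc y) refl = 1 , n-E-1+n , refl
step-towards (suc x) zero    refl = x , 1+n-E-n , ∣-∣-identityʳ x
step-towards (suc x) (suc y) eq with step-towards x y eq
... | z , xEz , z-y = suc z , E-suc xEz , z-y

2+[m+2k]≡m+2[1+k] : ∀ m k → 2 + (m + 2 * k) ≡ m + 2 * suc k
2+[m+2k]≡m+2[1+k] = solve-∀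

-- Each edge changes the distance to `y` by exactly one: a first step closer keeps the surplus
-- `2 * k`, a first step farther adds two to it.
π∈↑⇒ : ∀ n {x y} → π n ∈ ↑ 𝔊ℕ x y → ∃ λ k → n ≡ ∣ x - y ∣ + 2 * k
π∈↑⇒ zero    {x} refl = 0 , sym (trans (+-identityʳ _) (∣n-n∣≡0 x))
π∈↑⇒ (suc n) {x} {y} p with π-uncons 𝔊ℕ n p
... | z , xEz , q with π∈↑⇒ n q | E⇒distance±1 y xEz
... | k , refl | inj₂ closer  = k , cong (_+ 2 * k) (sym closer)
... | k , refl | inj₁ farther = suc k , trans (cong (λ m → suc (m + 2 * k)) farther) (2+[m+2k]≡m+2[1+k] ∣ x - y ∣ k)

geodesic : ∀ n x y → ∣ x - y ∣ ≡ n → π n ∈ ↑ 𝔊ℕ x y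
geodesic zero    x y eq = ∣m-n∣≡0⇒m≡n eq
geodesic (suc n) x y eq with step-towards x y eq
... | z , xEz , z-y = π-cons 𝔊ℕ n xEz (geodesic n z y z-y)

-- The detour goes from `x` to `suc x` and back; going up works at every vertex, whereas `0` has no
-- predecessor.
backtrack : ∀ n {x y} → π n ∈ ↑ 𝔊ℕ x y → π (2 + n) ∈ ↑ 𝔊ℕ x y
backtrack n p = π-cons 𝔊ℕ (suc n) n-E-1+n (π-cons 𝔊ℕ n 1+n-E-n p)

∣x-y∣+2k∈↑ : ∀ x y k → π (∣ x - y ∣ + 2 * k) ∈ ↑ 𝔊ℕ x y
∣x-y∣+2k∈↑ x y zero    = geodesic _ x y (sym (+-identityʳ ∣ x - y ∣))
∣x-y∣+2k∈↑ x y (suc k) =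
  subst (λ n → π n ∈ ↑ 𝔊ℕ x y) (2+[m+2k]≡m+2[1+k] ∣ x - y ∣ k) (backtrack _ (∣x-y∣+2k∈↑ x y k))

π∈↑⇒∣-∣≤ : ∀ n x y → π n ∈ ↑ 𝔊ℕ x y → ∣ x - y ∣ ≤ n
π∈↑⇒∣-∣≤ n x y p with π∈↑⇒ n p
... | _ , refl = m≤m+n _ _

equidistant⇒↑⊆↑ : ∀ a b c d → ∣ a - b ∣ ≡ ∣ c - d ∣ → ↑ 𝔊ℕ a b ⊆ ↑ 𝔊ℕ c d
equidistant⇒↑⊆↑ a b c d eq {π n} p with π∈↑⇒ n p
... | k , refl = subst (λ m → π (m + 2 * k) ∈ ↑ 𝔊ℕ c d) (sym eq) (∣x-y∣+2k∈↑ c d k)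

-- A walk of length `n` is too short to lead from `0` to `suc n`.
∉Trivial : ∀ φ → φ ∉ Trivial 𝔊ℕ
∉Trivial (π n) t = n≮n n (π∈↑⇒∣-∣≤ n 0 (suc n) (proj₁ (t 0 (suc n) 0 0)))

arrow⇒∣c-d∣≤∣a-b∣ : ∀ a b c d → ArrowProportion 𝔊ℕ a b c d → ∣ c - d ∣ ≤ ∣ a - b ∣
arrow⇒∣c-d∣≤∣a-b∣ a b c d (inj₁ trivial) =
  π∈↑⇒∣-∣≤ ∣ a - b ∣ c d (proj₁ (trivial {π ∣ a - b ∣} (inj₁ (geodesic _ a b refl)) c d c d))
arrow⇒∣c-d∣≤∣a-b∣ a b c d (inj₂ ((φ , φ∈ , φ∉) , maximal)) =
  -- Maximality returns `↑∩ a b c d′ ⊆ ↑∩ a b c d`. The shortest formula of `a → b` lies on the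
  -- left, so it also holds from `c` to `d` and bounds their distance.
  π∈↑⇒∣-∣≤ ∣ a - b ∣ c d (proj₂ (proj₂ (maximal d′ (Trivial⊂ , λ {φ} → enlarge {φ})) {π ∣ a - b ∣}
    (geodesic _ a b refl , geodesic _ c d′ d′-distance)))
  where
  d′ = c + ∣ a - b ∣

  d′-distance : ∣ c - d′ ∣ ≡ ∣ a - b ∣
  d′-distance = ∣m-m+n∣≡n c ∣ a - b ∣

  Trivial⊂ : Trivial 𝔊ℕ ⊂ ↑∩ 𝔊ℕ a b c d
  Trivial⊂ = (λ t → t a b c d) , λ ⊆Trivial → φ∉ (⊆Trivial {φ} φ∈)

  -- By the choice of `d′`, the type of `c → d′` contains that of `a → b`, so intersecting with it
  -- loses nothing.
  enlarge : ↑∩ 𝔊ℕ a b c d ⊆ ↑∩ 𝔊ℕ a b c d′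
  enlarge {φ} (p , _) = p , equidistant⇒↑⊆↑ a b c d′ (sym d′-distance) {φ} p

-- Here the intersection is all of `↑ 𝔊ℕ a b`, an upper bound for the intersection with any other
-- `d′`.
equidistant⇒arrow : ∀ a b c d → ∣ a - b ∣ ≡ ∣ c - d ∣ → ArrowProportion 𝔊ℕ a b c d
equidistant⇒arrow a b c d eq = inj₂ ((φ , φ∈ , ∉Trivial φ) , λ d′ (_ , ⊆d′) →
    ((λ t → t a b c d′) , λ ⊆Trivial → ∉Trivial φ (⊆Trivial {φ} (⊆d′ {φ} φ∈))) ,
    λ {ψ} (p , _) → p , equidistant⇒↑⊆↑ a b c d eq {ψ} p)
  where
  φ = π ∣ a - b ∣

  φ∈ : φ ∈ ↑∩ 𝔊ℕ a b c d
  φ∈ = geodesic _ a b refl , geodesic _ c d (sym eq)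

theorem18 : ∀ (a b c d : ℕ) → (𝔊ℕ ⊨ a ∶ b ∷ₚ c ∶ d) ⇔ (∣ a - b ∣ ≡ ∣ c - d ∣)
theorem18 a b c d = mk⇔
  (λ (ab⇒cd , _ , cd⇒ab , _) → ≤-antisym (arrow⇒∣c-d∣≤∣a-b∣ c d a b cd⇒ab) (arrow⇒∣c-d∣≤∣a-b∣ a b c d ab⇒cd))
  (λ eq → equidistant⇒arrow a b c d eq
        , equidistant⇒arrow b a d c (flipped eq)
        , equidistant⇒arrow c d a b (sym eq)
        , equidistant⇒arrow d c b a (sym (flipped eq)))
  where
  flipped : ∣ a - b ∣ ≡ ∣ c - d ∣ → ∣ b - a ∣ ≡ ∣ d - c ∣
  flipped eq = trans (∣-∣-comm b a) (trans eq (∣-∣-comm c d))
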